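{- Let $n>3$ be an integer and let $K_{n,n}$ be a weak ordered super EAT graph (that is, suppose $K_{n,n}$ admits a total labeling that is simultaneously weak ordered, super and edge-antimagic total). Then the join $K_{n,n}\oplus K_1$ is a TAT graph; that is, it admits a totally antimagic total labeling.
   Context: All graphs are finite, undirected and simple. $K_{n,n}$ is the complete bipartite graph with $n$ vertices in each partite set, and $K_1$ is the graph with one vertex. The join $G\oplus H$ of disjoint graphs $G$ and $H$ is the disjoint union $G\cup H$ together with all edges joining vertices of $V(G)$ to vertices of $V(H)$. Let $G$ be a graph with $p=|V(G)|$ vertices and $q=|E(G)|$ edges. A total labeling of $G$ is a bijection $f:V(G)\cup E(G)\to\{1,2,\dots,p+q\}$. It is super if $f(V(G))=\{1,2,\dots,p\}$. The edge-weight of $uv\in E(G)$ is $wt_f(uv)=f(u)+f(uv)+f(v)$, and the vertex-weight of $v\in V(G)$ is $wt_f(v)=f(v)+\sum_{u\in N(v)}f(uv)$, where $N(v)$ is the set of neighbors of $v$. The labeling $f$ is edge-antimagic total (EAT) if all edge-weights are pairwise distinct, and vertex-antimagic total (VAT) if all vertex-weights are pairwise distinct. It is totally antimagic total (TAT) if it is both EAT and VAT. A labeling $f$ is ordered on a set $S$ of vertices if $wt_f(u)\le wt_f(v)$ for every pair $u,v\in S$ with $f(u)<f(v)$. A labeling $f$ of $G$ is weak ordered if, for some positive integer $k$, the vertex set $V(G)$ can be partitioned into $k$ sets on each of which $f$ is ordered. -}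

module Defs where

open import Data.Empty using (⊥)
open import Data.Fin using (Fin; toℕ; splitAt; _<_)
open import Data.Fin.Properties using (<-cmp; _<?_)
open import Data.Fin.Subset using (Subset; _∈_; Nonempty)
open import Data.List using (allFin; cartesianProduct; filter; length)
open import Data.Nat as ℕ using (ℕ; suc; _+_; _≤_)
open import Data.Nat.Properties using (+-0-monoid)
open import Data.Product using (Σ; ∃; ∃!; _×_; _,_)
open import Data.Sum using (_⊎_; inj₁; inj₂)
open import Data.Unit using (⊤; tt)
open import Function using (Injective; _⇔_; _⤖_; Bijection)
open import Level using (0ℓ)
open import Relation.Binary using (Rel; Decidable; Symmetric; Irreflexive; tri<; tri≈; tri>)
open import Relation.Binary.PropositionalEquality using (_≡_; refl; cong)
open import Relation.Nullary using (Dec; yes; no; contradiction; _×-dec_)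

open import Algebra.Properties.Monoid.Sum +-0-monoid using (sum)

record Graph : Set₁ where
  infix 4 _~_ _~?_
  field
    order    : ℕ
    _~_      : Rel (Fin order) 0ℓ
    _~?_     : Decidable _~_
    ~-sym    : Symmetric _~_
    ~-irrefl : Irreflexive _≡_ _~_

  Vertex : Set
  Vertex = Fin order

  -- The unordered pair {u, v} is stored with its smaller endpoint first; the
  -- proof fields are irrelevant, so an edge is determined by its endpoints.
  record Edge : Set where
    constructor mkEdge
    field
      source target : Vertex
      .ordered      : source < target
      .adjacent     : source ~ target

  edge : ∀ {u v} → u ~ v → Edge
  edge {u} {v} u~v with <-cmp u v
  ... | tri< u<v _ _ = mkEdge u v u<v u~v
  ... | tri≈ _ u≡v _ = contradiction u~v (~-irrefl u≡v)
  ... | tri> _ _ v<u = mkEdge v u v<u (~-sym u~v)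

  size : ℕ
  size = length (filter (λ (u , v) → (u <? v) ×-dec (u ~? v))
                        (cartesianProduct (allFin order) (allFin order)))

edgeless : ℕ → Graph
edgeless n = record
  { order    = n
  ; _~_      = λ _ _ → ⊥
  ; _~?_     = λ _ _ → no λ ()
  ; ~-sym    = λ ()
  ; ~-irrefl = λ _ ()
  }

module _ (G H : Graph) where
  private
    module G = Graph G
    module H = Graph H

  JoinAdj : Rel (G.Vertex ⊎ H.Vertex) 0ℓ
  JoinAdj (inj₁ u) (inj₁ v) = u G.~ v
  JoinAdj (inj₁ _) (inj₂ _) = ⊤
  JoinAdj (inj₂ _) (inj₁ _) = ⊤
  JoinAdj (inj₂ u) (inj₂ v) = u H.~ v

  joinAdj? : Decidable JoinAdj
  joinAdj? (inj₁ u) (inj₁ v) = u G.~? v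
  joinAdj? (inj₁ _) (inj₂ _) = yes tt
  joinAdj? (inj₂ _) (inj₁ _) = yes tt
  joinAdj? (inj₂ u) (inj₂ v) = u H.~? v

  joinAdj-sym : ∀ x y → JoinAdj x y → JoinAdj y x
  joinAdj-sym (inj₁ _) (inj₁ _) p = G.~-sym p
  joinAdj-sym (inj₁ _) (inj₂ _) _ = tt
  joinAdj-sym (inj₂ _) (inj₁ _) _ = tt
  joinAdj-sym (inj₂ _) (inj₂ _) p = H.~-sym p

  joinAdj-irrefl : Irreflexive _≡_ JoinAdj
  joinAdj-irrefl {inj₁ _} refl = G.~-irrefl refl
  joinAdj-irrefl {inj₂ _} refl = H.~-irrefl refl

infixl 6 _⊕_

_⊕_ : Graph → Graph → Graph
G ⊕ H = record
  { order    = m + Graph.order H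
  ; _~_      = λ u v → JoinAdj G H (splitAt m u) (splitAt m v)
  ; _~?_     = λ u v → joinAdj? G H (splitAt m u) (splitAt m v)
  ; ~-sym    = λ {u} {v} → joinAdj-sym G H (splitAt m u) (splitAt m v)
  ; ~-irrefl = λ u≡v → joinAdj-irrefl G H (cong (splitAt m) u≡v)
  }
  where m = Graph.order G

K[_,_] : ℕ → ℕ → Graph
K[ m , n ] = edgeless m ⊕ edgeless n

K₁ : Graph
K₁ = edgeless 1

module _ (G : Graph) where
  open Graph G

  TotalLabeling : Set
  TotalLabeling = (Vertex ⊎ Edge) ⤖ Fin (order + size)

module _ {G : Graph} (f : TotalLabeling G) where
  open Graph G
  open Edge

  -- Fin counts from 0, whereas labels run over {1, …, p + q}.
  label : Vertex ⊎ Edge → ℕ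
  label x = suc (toℕ (Bijection.to f x))

  vertexLabel : Vertex → ℕ
  vertexLabel v = label (inj₁ v)

  edgeLabel : Edge → ℕ
  edgeLabel e = label (inj₂ e)

  edgeWeight : Edge → ℕ
  edgeWeight e = vertexLabel (source e) + edgeLabel e + vertexLabel (target e)

  edgeLabelOr0 : ∀ {u v} → Dec (u ~ v) → ℕ
  edgeLabelOr0 (yes u~v) = edgeLabel (edge u~v)
  edgeLabelOr0 (no _)    = 0

  vertexWeight : Vertex → ℕ
  vertexWeight v = vertexLabel v + sum (λ u → edgeLabelOr0 (u ~? v))

  Super : Set
  Super = ∀ k → (∃ λ v → vertexLabel v ≡ k) ⇔ (1 ≤ k × k ≤ order)

  EdgeAntimagic : Set
  EdgeAntimagic = Injective _≡_ _≡_ edgeWeight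

  VertexAntimagic : Set
  VertexAntimagic = Injective _≡_ _≡_ vertexWeight

  TotallyAntimagic : Set
  TotallyAntimagic = EdgeAntimagic × VertexAntimagic

  OrderedOn : Subset order → Set
  OrderedOn S = ∀ {u v} → u ∈ S → v ∈ S →
    vertexLabel u ℕ.< vertexLabel v → vertexWeight u ≤ vertexWeight v

  WeakOrdered : Set
  WeakOrdered = Σ ℕ λ k → 1 ≤ k × Σ (Fin k → Subset order) λ S →
    (∀ i → Nonempty (S i)) ×
    (∀ v → ∃! _≡_ λ i → v ∈ S i) ×
    (∀ i → OrderedOn (S i))

IsWeakOrderedSuperEAT : Graph → Set
IsWeakOrderedSuperEAT G =
  Σ (TotalLabeling G) λ f → WeakOrdered f × Super f × EdgeAntimagic f

IsTAT : Graph → Set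
IsTAT G = Σ (TotalLabeling G) TotallyAntimagic

{-# OPTIONS --safe #-}
module Submission where

-- An explicit labeling: write aᵢ, bⱼ (1 ≤ i, j ≤ n) for the two sides of K_{n,n} and c for the apex.
-- Put 0, …, (n+1)² - 1 in an (n+1) × (n+1) grid, drop the 0, and label bⱼ with entry (0, j), aᵢ with
-- entry (i, 0) and aᵢbⱼ with entry (i, j). With N = (n+1)², let c, bⱼc and aᵢc receive N, N + j and
-- N + n + i. The edge aᵢbⱼ then weighs twice its own label, which is less than 2N, while bⱼc and aᵢc
-- weigh 2N + 2j and 2N + n + (n+2)i. Vertex weights are affine in i and in j on the two sides, which
-- share no value, and the weight of c exceeds all others.

open import Defs
open import Data.Empty using (⊥)
open import Data.Fin using (Fin; zero; suc; toℕ; cast; _↑ˡ_; _↑ʳ_; combine; _<_)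
open import Data.Fin.Permutation using (↔⇒≡)
open import Data.Fin.Properties
  using (_<?_; <-cmp; +↔⊎; *↔×; toℕ<n; toℕ-injective; toℕ-cast; cast-involutive;
         toℕ-↑ˡ; toℕ-↑ʳ; toℕ-combine; splitAt-↑ˡ; splitAt-↑ʳ)
open import Data.List using (List; allFin; cartesianProduct; filter; lookup)
open import Data.List.Membership.Propositional using (_∈_)
open import Data.List.Membership.Propositional.Properties
  using (∈-filter⁺; ∈-cartesianProduct⁺; ∈-allFin; ∈-lookup)
open import Data.List.Relation.Unary.All as All using ()
open import Data.List.Relation.Unary.All.Properties using (all-filter)
open import Data.List.Relation.Unary.AllPairs using (_∷_)
open import Data.List.Relation.Unary.Any using (index)
open import Data.List.Relation.Unary.Any.Properties using (lookup-index)
open import Data.List.Relation.Unary.Unique.Propositional using (Unique)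
open import Data.List.Relation.Unary.Unique.Propositional.Properties
  using (filter⁺; cartesianProduct⁺; allFin⁺)
open import Data.Nat as ℕ using (ℕ; zero; suc; _+_; _*_; _≤_; _>_; z≤n; s≤s)
open import Data.Nat.Properties hiding (_<?_; <-cmp)
open import Data.Nat.Tactic.RingSolver using (solve-∀)
open import Data.Product using (∃; _×_; _,_; proj₁; proj₂)
open import Data.Sum using (_⊎_; inj₁; inj₂)
open import Data.Sum.Properties using (inj₂-injective)
open import Data.Unit using (tt)
open import Function using (_↔_; _∘_; Bijection; Inverse; Injective; mk↔ₛ′; mk⤖)
open import Function.Construct.Composition using (_↔-∘_)
open import Function.Construct.Identity using (↔-id)
open import Function.Construct.Symmetry using (↔-sym)
open import Function.Properties.Bijection using (⤖⇒↔)
open import Function.Properties.Inverse using (↔⇒⤖)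
open import Data.Sum.Function.Propositional using (_⊎-↔_)
open import Relation.Binary using (tri<; tri≈; tri>)
open import Relation.Binary.PropositionalEquality
  using (_≡_; refl; sym; trans; cong; cong₂; subst; subst₂; module ≡-Reasoning)
open import Relation.Nullary using (Dec; yes; no; ¬_; contradiction; _×-dec_; recompute)

open import Algebra.Properties.Monoid.Sum +-0-monoid using (sum; sum-cong-≗)
open import Algebra.Properties.CommutativeMonoid.Sum +-0-commutativeMonoid using (∑-distrib-+)
open import Algebra.Properties.Semiring.Sum +-*-semiring using (*-distribˡ-sum)

-- Duplicate-free lists, finite sums and triangular numbers.

lookup-injective : ∀ {A : Set} {xs : List A} → Unique xs → Injective _≡_ _≡_ (lookup xs)
lookup-injective (_ ∷ _)   {zero}  {zero}  _  = refl
lookup-injective (x∉ ∷ _)  {zero}  {suc j} eq = contradiction eq (All.lookup x∉ (∈-lookup j))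
lookup-injective (x∉ ∷ _)  {suc i} {zero}  eq = contradiction (sym eq) (All.lookup x∉ (∈-lookup i))
lookup-injective (_ ∷ xs!) {suc i} {suc j} eq = cong suc (lookup-injective xs! eq)

sum-↑ : ∀ m {k} (g : Fin (m + k) → ℕ) →
  sum g ≡ sum (λ i → g (i ↑ˡ k)) + sum (λ j → g (m ↑ʳ j))
sum-↑ zero    g = refl
sum-↑ (suc m) g = trans (cong (g zero +_) (sum-↑ m (g ∘ suc))) (sym (+-assoc (g zero) _ _))

sum-const : ∀ n x → sum {n} (λ _ → x) ≡ n * x
sum-const zero    x = refl
sum-const (suc n) x = cong (x +_) (sum-const n x)

triangle : ℕ → ℕ
triangle n = sum {n} (λ i → suc (toℕ i))

triangle-suc : ∀ n → triangle (suc n) ≡ suc n + triangle n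
triangle-suc n = cong suc (begin
  sum {n} (λ i → 1 + suc (toℕ i))     ≡⟨ ∑-distrib-+ {n} (λ _ → 1) (λ i → suc (toℕ i)) ⟩
  sum {n} (λ _ → 1) + triangle n      ≡⟨ cong (_+ triangle n) (trans (sum-const n 1) (*-identityʳ n)) ⟩
  n + triangle n                      ∎)
  where open ≡-Reasoning

-- Kept in doubled form to avoid division; the comparison of `a` and `b` weights is doubled for the
-- same reason.
2*triangle : ∀ n → 2 * triangle n ≡ n * suc n
2*triangle zero    = refl
2*triangle (suc n) = begin
  2 * triangle (suc n)         ≡⟨ cong (2 *_) (triangle-suc n) ⟩
  2 * (suc n + triangle n)     ≡⟨ *-distribˡ-+ 2 (suc n) (triangle n) ⟩
  2 * suc n + 2 * triangle n   ≡⟨ cong (2 * suc n +_) (2*triangle n) ⟩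
  2 * suc n + n * suc n        ≡⟨ lemma n ⟩
  suc n * suc (suc n)          ∎
  where
  open ≡-Reasoning
  lemma : ∀ n → 2 * suc n + n * suc n ≡ suc n * suc (suc n)
  lemma = solve-∀

triangle≤square : ∀ n → triangle n ≤ suc n * suc n
triangle≤square n = begin
  triangle n           ≤⟨ m≤m+n (triangle n) _ ⟩
  2 * triangle n       ≡⟨ 2*triangle n ⟩
  n * suc n            ≤⟨ *-monoˡ-≤ (suc n) (n≤1+n n) ⟩
  suc n * suc n        ∎
  where open ≤-Reasoning

-- Closed forms of the vertex weights and their separation.

aWeight bWeight : ℕ → ℕ → ℕ
aWeight n x = suc n * x + ((n * (suc n * x) + triangle n) + (suc n * suc n + (n + x)))
bWeight n y = y + ((suc n * triangle n + n * y) + (suc n * suc n + y))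

-- The apex label, then the labels of the edges `aᵢc`, then those of the edges `bⱼc`. As in the
-- formulas for the two sides, the brackets follow the summation order of `vertexWeight`.
cWeight : ℕ → ℕ
cWeight n = suc n * suc n + ((n * (suc n * suc n) + (n * n + triangle n)) + (n * (suc n * suc n) + triangle n))

-- The slope collects n + 1 from the vertex label, n(n + 1) from the edges `aᵢbⱼ` and 1 from the
-- apex edge, which makes N + 1.
aWeight-affine : ∀ n x → aWeight n x ≡ suc (suc n * suc n) * x + (triangle n + suc n * suc n + n)
-- The triangular number becomes a variable, leaving a polynomial identity for the ring solver.
aWeight-affine n x = lemma n x (triangle n)
  where
  lemma : ∀ n x t → suc n * x + ((n * (suc n * x) + t) + (suc n * suc n + (n + x)))
                  ≡ suc (suc n * suc n) * x + (t + suc n * suc n + n)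
  lemma = solve-∀

bWeight-affine : ∀ n y → bWeight n y ≡ (2 + n) * y + (suc n * triangle n + suc n * suc n)
bWeight-affine n y = lemma n y (triangle n)
  where
  lemma : ∀ n y t → y + ((suc n * t + n * y) + (suc n * suc n + y)) ≡ (2 + n) * y + (suc n * t + suc n * suc n)
  lemma = solve-∀

aWeight-injective : ∀ n {x y} → aWeight n x ≡ aWeight n y → x ≡ y
aWeight-injective n {x} {y} eq = *-cancelˡ-≡ x y (suc (suc n * suc n)) (+-cancelʳ-≡ _ _ _
  (trans (sym (aWeight-affine n x)) (trans eq (aWeight-affine n y))))

bWeight-injective : ∀ n {x y} → bWeight n x ≡ bWeight n y → x ≡ y
bWeight-injective n {x} {y} eq = *-cancelˡ-≡ x y (2 + n) (+-cancelʳ-≡ _ _ _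
  (trans (sym (bWeight-affine n x)) (trans eq (bWeight-affine n y))))

-- The weight is largest at `x = n`. With `n = suc m` the remaining gap is a polynomial in `m` with
-- natural coefficients, hence visibly positive.
aWeight<cWeight : ∀ m {x} → x ≤ suc m → aWeight (suc m) x ℕ.< cWeight (suc m)
aWeight<cWeight m {x} x≤n = begin-strict
  aWeight n x                                            ≡⟨ aWeight-affine n x ⟩
  suc (suc n * suc n) * x + (triangle n + suc n * suc n + n) ≤⟨ +-monoˡ-≤ _ (*-monoʳ-≤ (suc (suc n * suc n)) x≤n) ⟩
  suc (suc n * suc n) * n + (triangle n + suc n * suc n + n) <⟨ m<m+n _ (s≤s z≤n) ⟩
  suc (suc n * suc n) * n + (triangle n + suc n * suc n + n)
    + suc (m * m * m + 6 * (m * m) + 8 * m + 2 + triangle n) ≡⟨ lemma m (triangle n) ⟩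
  cWeight n                                              ∎
  where
  open ≤-Reasoning
  n = suc m
  lemma : ∀ m t → suc (suc (suc m) * suc (suc m)) * suc m + (t + suc (suc m) * suc (suc m) + suc m)
                    + suc (m * m * m + 6 * (m * m) + 8 * m + 2 + t)
                ≡ suc (suc m) * suc (suc m) + ((suc m * (suc (suc m) * suc (suc m)) + (suc m * suc m + t))
                    + (suc m * (suc (suc m) * suc (suc m)) + t))
  lemma = solve-∀

bWeight<cWeight : ∀ m {y} → y ≤ suc m → bWeight (suc m) y ℕ.< cWeight (suc m)
bWeight<cWeight m {y} y≤n = begin-strict
  bWeight n y                                            ≡⟨ bWeight-affine n y ⟩
  -- Of the n + 1 copies of `triangle n` one is kept and the other n are bounded by N each;
  -- `cWeight` contains only two copies.
  (2 + n) * y + (suc n * triangle n + suc n * suc n)     ≤⟨ +-mono-≤ (*-monoʳ-≤ (2 + n) y≤n)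
    (+-monoˡ-≤ (suc n * suc n) (+-monoʳ-≤ (triangle n) (*-monoʳ-≤ n (triangle≤square n)))) ⟩
  (2 + n) * n + ((triangle n + n * (suc n * suc n)) + suc n * suc n) <⟨ m<m+n _ (s≤s z≤n) ⟩
  (2 + n) * n + ((triangle n + n * (suc n * suc n)) + suc n * suc n)
    + suc (m * m * m + 5 * (m * m) + 6 * m + 1 + triangle n) ≡⟨ lemma m (triangle n) ⟩
  cWeight n                                              ∎
  where
  open ≤-Reasoning
  n = suc m
  lemma : ∀ m t → (2 + suc m) * suc m + ((t + suc m * (suc (suc m) * suc (suc m))) + suc (suc m) * suc (suc m))
                    + suc (m * m * m + 5 * (m * m) + 6 * m + 1 + t)
                ≡ suc (suc m) * suc (suc m) + ((suc m * (suc (suc m) * suc (suc m)) + (suc m * suc m + t))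
                    + (suc m * (suc (suc m) * suc (suc m)) + t))
  lemma = solve-∀

-- After doubling, one triangular number cancels and the n others are evaluated. With `k` removed,
-- n(n(n + 1) - 2) = n(n + 2)(n - 1) shows that every term except `4 * x` is a multiple of n + 2,
-- written `3 + m`.
aWeight≡bWeight⇒ : ∀ m x y → aWeight (suc m) x ≡ bWeight (suc m) y →
  (3 + m) * (2 * (suc m * x)) + 4 * x ≡ (3 + m) * (2 * y + suc m * m)
aWeight≡bWeight⇒ m x y eq = +-cancelʳ-≡ k _ _ (begin
  (3 + m) * (2 * (n * x)) + 4 * x + k                     ≡⟨ lemma₁ m x t ⟩
  2 * aWeight n x                                         ≡⟨ cong (2 *_) eq ⟩
  2 * bWeight n y                                         ≡⟨ lemma₂ m y t ⟩
  2 * ((3 + m) * y) + 2 * (suc n * suc n) + 2 * t + n * (2 * t)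
    ≡⟨ cong (λ z → 2 * ((3 + m) * y) + 2 * (suc n * suc n) + 2 * t + n * z) (2*triangle n) ⟩
  2 * ((3 + m) * y) + 2 * (suc n * suc n) + 2 * t + n * (n * suc n) ≡⟨ lemma₃ m y t ⟩
  (3 + m) * (2 * y + n * m) + k                           ∎)
  where
  open ≡-Reasoning
  n = suc m
  t = triangle (suc m)
  k = 2 * t + 2 * (suc n * suc n) + 2 * n
  lemma₁ : ∀ m x t → (3 + m) * (2 * (suc m * x)) + 4 * x + (2 * t + 2 * (suc (suc m) * suc (suc m)) + 2 * suc m)
    ≡ 2 * (suc (suc m) * x + ((suc m * (suc (suc m) * x) + t) + (suc (suc m) * suc (suc m) + (suc m + x))))
  lemma₁ = solve-∀
  lemma₂ : ∀ m y t → 2 * (y + ((suc (suc m) * t + suc m * y) + (suc (suc m) * suc (suc m) + y)))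
    ≡ 2 * ((3 + m) * y) + 2 * (suc (suc m) * suc (suc m)) + 2 * t + suc m * (2 * t)
  lemma₂ = solve-∀
  lemma₃ : ∀ m y t → 2 * ((3 + m) * y) + 2 * (suc (suc m) * suc (suc m)) + 2 * t + suc m * (suc m * suc (suc m))
    ≡ (3 + m) * (2 * y + suc m * m) + (2 * t + 2 * (suc (suc m) * suc (suc m)) + 2 * suc m)
  lemma₃ = solve-∀

-- A collision forces 4x = (n + 2)d for some d ≥ 1, and then 4y + 2n(n - 1) = (n(n + 2) + 2)d.
-- For d = 1 the right side is too small (as n ≥ 4), for d ≥ 2 it exceeds the value at y = n.
aWeight≢bWeight : ∀ k {x y} → let n = 4 + k in 1 ≤ x → 1 ≤ y → y ≤ n → ¬ (aWeight n x ≡ bWeight n y)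
aWeight≢bWeight k {x} {y} 1≤x 1≤y y≤n eq = refute difference
  where
  n = 4 + k
  m = 3 + k
  R = 2 * (n * x)
  L = 2 * y + n * m

  scaled : (3 + m) * R + 4 * x ≡ (3 + m) * L
  scaled = aWeight≡bWeight⇒ m x y eq

  R<L : R ℕ.< L
  -- As `4 * x` is positive, `scaled` makes the multiple of `R` the smaller one, and the common
  -- factor cancels.
  R<L = *-cancelˡ-< (3 + m) R L (subst ((3 + m) * R ℕ.<_) scaled
    (m<m+n ((3 + m) * R) (≤-trans 1≤x (m≤m+n x (3 * x)))))

  difference : ∃ λ d → L ≡ R + suc d
  difference = L ℕ.∸ suc R , trans (sym (m+[n∸m]≡n R<L)) (sym (+-suc R (L ℕ.∸ suc R)))

  module _ (d : ℕ) (L≡ : L ≡ R + d) where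
    4x≡ : 4 * x ≡ (3 + m) * d
    4x≡ = +-cancelˡ-≡ ((3 + m) * R) _ _
      (trans scaled (trans (cong ((3 + m) *_) L≡) (*-distribˡ-+ (3 + m) R d)))

    2L≡ : 2 * L ≡ n * ((3 + m) * d) + 2 * d
    2L≡ = begin
      2 * L                       ≡⟨ cong (2 *_) L≡ ⟩
      -- Doubling turns `R` into `n * (4 * x)`, so that `x` can be eliminated.
      2 * (R + d)                 ≡⟨ lemma n x d ⟩
      n * (4 * x) + 2 * d         ≡⟨ cong (λ z → n * z + 2 * d) 4x≡ ⟩
      n * ((3 + m) * d) + 2 * d   ∎
      where
      open ≡-Reasoning
      lemma : ∀ n x d → 2 * (2 * (n * x) + d) ≡ n * (4 * x) + 2 * d
      lemma = solve-∀

  refute : (∃ λ d → L ≡ R + suc d) → ⊥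
  refute (zero , L≡) = <-irrefl (sym (2L≡ 1 L≡)) (begin-strict
    n * ((3 + m) * 1) + 2 * 1   <⟨ m<m+n _ (s≤s z≤n) ⟩
    -- The slack is n² - 4n + 2, positive from n = 4 on but negative at n = 3: the bound `n > 3`
    -- enters here.
    n * ((3 + m) * 1) + 2 * 1 + suc (1 + 4 * k + k * k) ≡⟨ lemma k ⟩
    2 * (2 * 1 + n * m)         ≤⟨ *-monoʳ-≤ 2 (+-monoˡ-≤ (n * m) (*-monoʳ-≤ 2 1≤y)) ⟩
    2 * L                       ∎)
    where
    open ≤-Reasoning
    lemma : ∀ k → (4 + k) * ((6 + k) * 1) + 2 * 1 + suc (1 + 4 * k + k * k) ≡ 2 * (2 * 1 + (4 + k) * (3 + k))
    lemma = solve-∀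
  refute (suc d , L≡) = <-irrefl (2L≡ (2 + d) L≡) (begin-strict
    2 * L                       ≤⟨ *-monoʳ-≤ 2 (+-monoˡ-≤ (n * m) (*-monoʳ-≤ 2 y≤n)) ⟩
    2 * (2 * n + n * m)         <⟨ m<m+n _ (s≤s z≤n) ⟩
    -- The slack is 2n + 4 for the multiplier 2, and each further unit of `d` adds n(n + 2) + 2.
    2 * (2 * n + n * m) + suc (11 + 2 * k + (4 + k) * (6 + k) * d + 2 * d) ≡⟨ lemma k d ⟩
    n * ((3 + m) * (2 + d)) + 2 * (2 + d) ∎)
    where
    open ≤-Reasoning
    lemma : ∀ k d → 2 * (2 * (4 + k) + (4 + k) * (3 + k)) + suc (11 + 2 * k + (4 + k) * (6 + k) * d + 2 * d)
                  ≡ (4 + k) * ((6 + k) * (2 + d)) + 2 * (2 + d)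
    lemma = solve-∀

-- Enumerating the edges of a graph.

cast↔ : ∀ {m n} → m ≡ n → Fin m ↔ Fin n
cast↔ eq = mk↔ₛ′ (cast eq) (cast (sym eq)) (cast-involutive eq (sym eq)) (cast-involutive (sym eq) eq)

module _ (G : Graph) where
  open Graph G

  private
    isEdge? : (p : Vertex × Vertex) → Dec (proj₁ p < proj₂ p × proj₁ p ~ proj₂ p)
    isEdge? (u , v) = (u <? v) ×-dec (u ~? v)

    pairs : List (Vertex × Vertex)
    pairs = cartesianProduct (allFin order) (allFin order)

    pairs! : Unique (filter isEdge? pairs)
    pairs! = filter⁺ isEdge? (cartesianProduct⁺ (allFin⁺ order) (allFin⁺ order))

  edgeAt : Fin size → Edge
  edgeAt i = let u<v , u~v = All.lookup (all-filter isEdge? pairs) (∈-lookup i)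
             in mkEdge _ _ u<v u~v

  private
    ends : Edge → Vertex × Vertex
    ends e = Edge.source e , Edge.target e

    ends-injective : Injective _≡_ _≡_ ends
    ends-injective {mkEdge u v _ _} {mkEdge _ _ _ _} refl = refl

    edgeAt-surjective : ∀ e → ∃ λ i → edgeAt i ≡ e
    edgeAt-surjective (mkEdge u v u<v u~v) = index e∈ , ends-injective (sym (lookup-index e∈))
      where
      e∈ : (u , v) ∈ filter isEdge? pairs
      e∈ = ∈-filter⁺ isEdge? (∈-cartesianProduct⁺ (∈-allFin u) (∈-allFin v))
             -- The fields of an edge are irrelevant, while membership needs actual proofs; the
             -- decision procedures restore them.
             (recompute (u <? v) u<v , recompute (u ~? v) u~v)

  -- `size` is defined as the length of a list of pairs; this identifies it with the cardinality of
  -- `Edge`.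
  Fin-size↔Edge : Fin size ↔ Edge
  Fin-size↔Edge = ⤖⇒↔ (mk⤖ {to = edgeAt}
    ( (λ {i} {j} eq → lookup-injective pairs! {i} {j} (cong ends eq))
    , λ e → let i , eq = edgeAt-surjective e in i , λ { refl → eq }))

-- Labels of edges seen from their ends.

module _ {G : Graph} (f : TotalLabeling G) where
  open Graph G

  edgeLabelOr0-no : ∀ {u v} (d : Dec (u ~ v)) → ¬ (u ~ v) → edgeLabelOr0 f d ≡ 0
  edgeLabelOr0-no (yes p) ¬p = contradiction p ¬p
  edgeLabelOr0-no (no _)  _  = refl

  -- `edge` stores the smaller end first, so knowing the order of the ends selects its branch;
  -- irrelevance identifies the proofs inside the edge.
  edgeLabelOr0-< : ∀ {u v} (d : Dec (u ~ v)) (u<v : u < v) (p : u ~ v) →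
    edgeLabelOr0 f d ≡ edgeLabel f (mkEdge u v u<v p)
  edgeLabelOr0-< (no ¬p) _ p = contradiction p ¬p
  edgeLabelOr0-< {u} {v} (yes p) u<v _ with <-cmp u v
  ... | tri< _ _ _   = refl
  ... | tri≈ ¬u<v _ _ = contradiction u<v ¬u<v
  ... | tri> ¬u<v _ _ = contradiction u<v ¬u<v

  edgeLabelOr0-> : ∀ {u v} (d : Dec (u ~ v)) (v<u : v < u) (p : v ~ u) →
    edgeLabelOr0 f d ≡ edgeLabel f (mkEdge v u v<u p)
  edgeLabelOr0-> (no ¬p) _ p = contradiction (~-sym p) ¬p
  edgeLabelOr0-> {u} {v} (yes p) v<u _ with <-cmp u v
  ... | tri< _ _ ¬v<u = contradiction v<u ¬v<u
  ... | tri≈ _ _ ¬v<u = contradiction v<u ¬v<u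
  ... | tri> _ _ _   = refl

-- Coordinates for the vertices and edges of the join.

Place Link : ℕ → Set
Place n = (Fin n ⊎ Fin n) ⊎ Fin 1
Link  n = (Fin n × Fin n) ⊎ (Fin n ⊎ Fin n)

pattern a i = inj₁ (inj₁ i)
pattern b j = inj₁ (inj₂ j)
pattern c   = inj₂ zero

pattern ab i j = inj₁ (i , j)
pattern bc j   = inj₂ (inj₁ j)
pattern ac i   = inj₂ (inj₂ i)

module Labeling (n : ℕ) where

  K : Graph
  K = K[ n , n ] ⊕ K₁
  open Graph K

  Vertex↔Place : Vertex ↔ Place n
  Vertex↔Place = (+↔⊎ ⊎-↔ ↔-id (Fin 1)) ↔-∘ +↔⊎

  vertex : Place n → Vertex
  vertex = Inverse.from Vertex↔Place

  a<b : ∀ i j → vertex (a i) < vertex (b j)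
  a<b i j rewrite toℕ-↑ˡ (i ↑ˡ n) 1 | toℕ-↑ˡ i n | toℕ-↑ˡ (n ↑ʳ j) 1 | toℕ-↑ʳ n j =
    <-≤-trans (toℕ<n i) (m≤m+n n (toℕ j))

  x<c : ∀ x → vertex (inj₁ x) < vertex c
  x<c x rewrite toℕ-↑ˡ (Inverse.from (+↔⊎ {n} {n}) x) 1 | toℕ-↑ʳ (n + n) (zero {0}) | +-identityʳ (n + n) =
    toℕ<n (Inverse.from (+↔⊎ {n} {n}) x)

  a~b : ∀ i j → vertex (a i) ~ vertex (b j)
  a~b i j rewrite splitAt-↑ˡ (n + n) (i ↑ˡ n) 1 | splitAt-↑ˡ (n + n) (n ↑ʳ j) 1
                | splitAt-↑ˡ n i n | splitAt-↑ʳ n n j = tt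

  x~c : ∀ x → vertex (inj₁ x) ~ vertex c
  x~c x rewrite splitAt-↑ˡ (n + n) (Inverse.from (+↔⊎ {n} {n}) x) 1 | splitAt-↑ʳ (n + n) 1 zero = tt

  ¬a~a : ∀ i j → ¬ (vertex (a i) ~ vertex (a j))
  ¬a~a i j rewrite splitAt-↑ˡ (n + n) (i ↑ˡ n) 1 | splitAt-↑ˡ (n + n) (j ↑ˡ n) 1
                | splitAt-↑ˡ n i n | splitAt-↑ˡ n j n = λ ()

  ¬b~b : ∀ i j → ¬ (vertex (b i) ~ vertex (b j))
  ¬b~b i j rewrite splitAt-↑ˡ (n + n) (n ↑ʳ i) 1 | splitAt-↑ˡ (n + n) (n ↑ʳ j) 1
                | splitAt-↑ʳ n n i | splitAt-↑ʳ n n j = λ ()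

  ¬c~c : ¬ (vertex c ~ vertex c)
  ¬c~c = ~-irrefl {x = vertex c} refl

  -- The orientation follows the vertex numbering, in which all `a` precede all `b` and the apex is
  -- last, so it fits `mkEdge`.
  start end : Link n → Place n
  start (ab i _) = a i
  start (bc j)   = b j
  start (ac i)   = a i
  end (ab _ j) = b j
  end (bc _)   = c
  end (ac _)   = c

  start<end : ∀ l → vertex (start l) < vertex (end l)
  start<end (ab i j) = a<b i j
  start<end (bc j)   = x<c (inj₂ j)
  start<end (ac i)   = x<c (inj₁ i)

  start~end : ∀ l → vertex (start l) ~ vertex (end l)
  start~end (ab i j) = a~b i j
  start~end (bc j)   = x~c (inj₂ j)
  start~end (ac i)   = x~c (inj₁ i)

  linkEdge : Link n → Edge
  linkEdge l = mkEdge (vertex (start l)) (vertex (end l)) (start<end l) (start~end l)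

  vertex-injective : ∀ {x y} → vertex x ≡ vertex y → x ≡ y
  vertex-injective {x} {y} eq =
    trans (sym (Inverse.strictlyInverseˡ Vertex↔Place x))
      (trans (cong (Inverse.to Vertex↔Place) eq) (Inverse.strictlyInverseˡ Vertex↔Place y))

  ends-injective : ∀ l m → start l ≡ start m → end l ≡ end m → l ≡ m
  ends-injective (ab _ _) (ab _ _) refl refl = refl
  ends-injective (ab _ _) (bc _)   () _
  ends-injective (ab _ _) (ac _)   _ ()
  ends-injective (bc _)   (ab _ _) () _
  ends-injective (bc _)   (bc _)   refl refl = refl
  ends-injective (bc _)   (ac _)   () _
  ends-injective (ac _)   (ab _ _) _ ()
  ends-injective (ac _)   (bc _)   () _
  ends-injective (ac _)   (ac _)   refl refl = refl

  linkEdge-injective : ∀ {l m} → linkEdge l ≡ linkEdge m → l ≡ m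
  linkEdge-injective {l} {m} eq = ends-injective l m
    (vertex-injective (cong Edge.source eq)) (vertex-injective (cong Edge.target eq))

  -- Pairs within one side or at the apex alone are not adjacent or not increasing, and reversed
  -- pairs contradict the order; the three kinds of links remain.
  link : ∀ x y → vertex x < vertex y → vertex x ~ vertex y → ∃ λ l → start l ≡ x × end l ≡ y
  link (a i) (a j) _ p = contradiction p (¬a~a i j)
  link (a i) (b j) _ _ = ab i j , refl , refl
  link (a i) c     _ _ = ac i , refl , refl
  link (b j) (a i) lt _ = contradiction lt (<-asym (a<b i j))
  link (b i) (b j) _ p = contradiction p (¬b~b i j)
  link (b j) c     _ _ = bc j , refl , refl
  link c (inj₁ x) lt _ = contradiction lt (<-asym (x<c x))
  link c c lt _ = contradiction lt (<-irrefl refl)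

  vertex-place : ∀ v → vertex (Inverse.to Vertex↔Place v) ≡ v
  vertex-place = Inverse.strictlyInverseʳ Vertex↔Place

  linkEdge-surjective : ∀ e → ∃ λ l → linkEdge l ≡ e
  linkEdge-surjective (mkEdge u v u<v u~v) =
    go {Inverse.to Vertex↔Place u} {Inverse.to Vertex↔Place v} (vertex-place u) (vertex-place v)
       (recompute (u <? v) u<v) (recompute (u ~? v) u~v)
    where
    go : ∀ {x y u v} → vertex x ≡ u → vertex y ≡ v → (lt : u < v) (p : u ~ v) →
         ∃ λ l → linkEdge l ≡ mkEdge u v lt p
    go {x} {y} refl refl lt p with link x y lt p
    ... | l , refl , refl = l , refl

  Link↔Edge : Link n ↔ Edge
  Link↔Edge = ⤖⇒↔ (mk⤖
    (linkEdge-injective , λ e → let l , eq = linkEdge-surjective e in l , λ { refl → eq }))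

  -- The grid labeling.

  gridCells : (Place n ⊎ Link n) ↔ ((Fin n ⊎ Fin n × Fin (suc n)) ⊎ (Fin 1 ⊎ (Fin n ⊎ Fin n)))
  gridCells = mk↔ₛ′ to from to∘from from∘to
    where
    to : Place n ⊎ Link n → (Fin n ⊎ Fin n × Fin (suc n)) ⊎ (Fin 1 ⊎ (Fin n ⊎ Fin n))
    -- The first summand is the grid without its corner: row 0 holds the `b`, and each later row
    -- holds an `a` in column zero followed by its edges `ab`. The second summand receives the
    -- labels from N on.
    to (inj₁ (b j))    = inj₁ (inj₁ j)
    to (inj₁ (a i))    = inj₁ (inj₂ (i , zero))
    to (inj₂ (ab i j)) = inj₁ (inj₂ (i , suc j))
    to (inj₁ c)        = inj₂ (inj₁ zero)
    to (inj₂ (bc j))   = inj₂ (inj₂ (inj₁ j))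
    to (inj₂ (ac i))   = inj₂ (inj₂ (inj₂ i))

    from : (Fin n ⊎ Fin n × Fin (suc n)) ⊎ (Fin 1 ⊎ (Fin n ⊎ Fin n)) → Place n ⊎ Link n
    from (inj₁ (inj₁ j))           = inj₁ (b j)
    from (inj₁ (inj₂ (i , zero)))  = inj₁ (a i)
    from (inj₁ (inj₂ (i , suc j))) = inj₂ (ab i j)
    from (inj₂ (inj₁ zero))        = inj₁ c
    from (inj₂ (inj₂ (inj₁ j)))    = inj₂ (bc j)
    from (inj₂ (inj₂ (inj₂ i)))    = inj₂ (ac i)

    to∘from : ∀ x → to (from x) ≡ x
    to∘from (inj₁ (inj₁ _))           = refl
    to∘from (inj₁ (inj₂ (_ , zero)))  = refl
    to∘from (inj₁ (inj₂ (_ , suc _))) = refl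
    to∘from (inj₂ (inj₁ zero))        = refl
    to∘from (inj₂ (inj₂ (inj₁ _)))    = refl
    to∘from (inj₂ (inj₂ (inj₂ _)))    = refl

    from∘to : ∀ x → from (to x) ≡ x
    from∘to (inj₁ (b _))    = refl
    from∘to (inj₁ (a _))    = refl
    from∘to (inj₂ (ab _ _)) = refl
    from∘to (inj₁ c)        = refl
    from∘to (inj₂ (bc _))   = refl
    from∘to (inj₂ (ac _))   = refl

  numbering : (Place n ⊎ Link n) ↔ Fin ((n + n * suc n) + (1 + (n + n)))
  numbering = ↔-sym cells ↔-∘ gridCells
    where
    cells : Fin ((n + n * suc n) + (1 + (n + n))) ↔ ((Fin n ⊎ Fin n × Fin (suc n)) ⊎ (Fin 1 ⊎ (Fin n ⊎ Fin n)))
    cells = (((↔-id (Fin n) ⊎-↔ *↔×) ↔-∘ +↔⊎) ⊎-↔ ((↔-id (Fin 1) ⊎-↔ +↔⊎) ↔-∘ +↔⊎)) ↔-∘ +↔⊎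

  -- The `suc` matches the one in `label` and also makes up for the dropped corner, so numbers
  -- coincide with grid entries.
  number : Place n ⊎ Link n → ℕ
  number x = suc (toℕ (Inverse.to numbering x))

  -- No edges are counted: both sides are cardinalities of sets in bijection with
  -- `Place n ⊎ Link n`.
  total : (n + n * suc n) + (1 + (n + n)) ≡ order + size
  total = ↔⇒≡ (↔-sym (+↔⊎ {order} {size}) ↔-∘
    ((↔-sym Vertex↔Place ⊎-↔ (↔-sym (Fin-size↔Edge K) ↔-∘ Link↔Edge)) ↔-∘ ↔-sym numbering))

  labeling : TotalLabeling K
  labeling = ↔⇒⤖ (cast↔ total ↔-∘ (numbering ↔-∘ (Vertex↔Place ⊎-↔ ↔-sym Link↔Edge)))

  -- Values of the labels.

  vertexLabel-vertex : ∀ x → vertexLabel labeling (vertex x) ≡ number (inj₁ x)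
  vertexLabel-vertex x = cong suc (trans (toℕ-cast total _)
    (cong (toℕ ∘ Inverse.to numbering ∘ inj₁) (Inverse.strictlyInverseˡ Vertex↔Place x)))

  edgeLabel-linkEdge : ∀ l → edgeLabel labeling (linkEdge l) ≡ number (inj₂ l)
  edgeLabel-linkEdge l = cong suc (trans (toℕ-cast total _)
    (cong (toℕ ∘ Inverse.to numbering ∘ inj₂) (Inverse.strictlyInverseʳ Link↔Edge l)))

  number-injective : ∀ {x y} → number x ≡ number y → x ≡ y
  number-injective eq = Bijection.injective (↔⇒⤖ numbering) (toℕ-injective (suc-injective eq))

  number-b : ∀ j → number (inj₁ (b j)) ≡ suc (toℕ j)
  number-b j = cong suc (trans (toℕ-↑ˡ (j ↑ˡ (n * suc n)) _) (toℕ-↑ˡ j (n * suc n)))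

  -- The n entries of row 0 and the successor together fill one row of length n + 1, which shifts
  -- the row index by one.
  number-grid : ∀ (i : Fin n) (j : Fin (suc n)) →
    suc (toℕ ((n ↑ʳ combine i j) ↑ˡ (1 + (n + n)))) ≡ suc n * suc (toℕ i) + toℕ j
  number-grid i j = begin
    suc (toℕ ((n ↑ʳ combine i j) ↑ˡ (1 + (n + n)))) ≡⟨ cong suc (toℕ-↑ˡ (n ↑ʳ combine i j) _) ⟩
    suc (toℕ (n ↑ʳ combine i j))                    ≡⟨ cong suc (toℕ-↑ʳ n (combine i j)) ⟩
    suc n + toℕ (combine i j)                       ≡⟨ cong (suc n +_) (toℕ-combine i j) ⟩
    suc n + (suc n * toℕ i + toℕ j)                 ≡⟨ +-assoc (suc n) (suc n * toℕ i) (toℕ j) ⟨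
    suc n + suc n * toℕ i + toℕ j                   ≡⟨ cong (_+ toℕ j) (*-suc (suc n) (toℕ i)) ⟨
    suc n * suc (toℕ i) + toℕ j                     ∎
    where open ≡-Reasoning

  number-a : ∀ i → number (inj₁ (a i)) ≡ suc n * suc (toℕ i)
  number-a i = trans (number-grid i zero) (+-identityʳ _)

  number-ab : ∀ i j → number (inj₂ (ab i j)) ≡ suc n * suc (toℕ i) + suc (toℕ j)
  number-ab i j = number-grid i (suc j)

  number-top : ∀ (k : Fin (1 + (n + n))) →
    suc (toℕ ((n + n * suc n) ↑ʳ k)) ≡ suc n * suc n + toℕ k
  -- `suc (n + n * suc n)` computes to `suc n * suc n`.
  number-top k = cong suc (toℕ-↑ʳ (n + n * suc n) k)

  number-c : number (inj₁ c) ≡ suc n * suc n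
  number-c = trans (number-top zero) (+-identityʳ _)

  number-bc : ∀ j → number (inj₂ (bc j)) ≡ suc n * suc n + suc (toℕ j)
  number-bc j = trans (number-top (suc (j ↑ˡ n))) (cong (λ x → suc n * suc n + suc x) (toℕ-↑ˡ j n))

  number-ac : ∀ i → number (inj₂ (ac i)) ≡ suc n * suc n + (n + suc (toℕ i))
  number-ac i = trans (number-top (suc (n ↑ʳ i)))
    (cong (suc n * suc n +_) (trans (cong suc (toℕ-↑ʳ n i)) (sym (+-suc n (toℕ i)))))

  -- Edge weights.

  edgeWeight-linkEdge : ∀ l {x y z} →
    number (inj₁ (start l)) ≡ x → number (inj₂ l) ≡ y → number (inj₁ (end l)) ≡ z →
    edgeWeight labeling (linkEdge l) ≡ x + y + z
  edgeWeight-linkEdge l p q r = cong₂ _+_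
    (cong₂ _+_ (trans (vertexLabel-vertex (start l)) p) (trans (edgeLabel-linkEdge l) q))
    (trans (vertexLabel-vertex (end l)) r)

  -- Grid entry (i, j) is the sum of entries (i, 0) and (0, j), the labels of the two ends.
  edgeWeight-ab : ∀ i j → edgeWeight labeling (linkEdge (ab i j)) ≡ 2 * number (inj₂ (ab i j))
  edgeWeight-ab i j =
    trans (edgeWeight-linkEdge (ab i j) (number-a i) (number-ab i j) (number-b j))
      (trans (lemma (suc n * suc (toℕ i)) (suc (toℕ j))) (cong (2 *_) (sym (number-ab i j))))
    where
    lemma : ∀ x y → x + (x + y) + y ≡ 2 * (x + y)
    lemma = solve-∀

  edgeWeight-bc : ∀ j → edgeWeight labeling (linkEdge (bc j)) ≡ 2 * suc (toℕ j) + 2 * (suc n * suc n)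
  edgeWeight-bc j = trans (edgeWeight-linkEdge (bc j) (number-b j) (number-bc j) number-c)
    (lemma (suc (toℕ j)) (suc n * suc n))
    where
    lemma : ∀ y z → y + (z + y) + z ≡ 2 * y + 2 * z
    lemma = solve-∀

  edgeWeight-ac : ∀ i →
    edgeWeight labeling (linkEdge (ac i)) ≡ ((2 + n) * suc (toℕ i) + n) + 2 * (suc n * suc n)
  edgeWeight-ac i = trans (edgeWeight-linkEdge (ac i) (number-a i) (number-ac i) number-c)
    (lemma n (suc (toℕ i)) (suc n * suc n))
    where
    lemma : ∀ n x z → suc n * x + (z + (n + x)) + z ≡ ((2 + n) * x + n) + 2 * z
    lemma = solve-∀

  edgeWeight-ab< : ∀ i j → edgeWeight labeling (linkEdge (ab i j)) ℕ.< 2 * (suc n * suc n)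
  edgeWeight-ab< i j = subst (ℕ._< 2 * (suc n * suc n)) (sym (edgeWeight-ab i j))
    (*-monoʳ-< 2 (subst (ℕ._< suc n * suc n) (sym (number-ab i j)) (begin-strict
      suc n * suc (toℕ i) + suc (toℕ j) ≤⟨ +-mono-≤ (*-monoʳ-≤ (suc n) (toℕ<n i)) (toℕ<n j) ⟩
      suc n * n + n                     <⟨ +-monoʳ-< (suc n * n) (n<1+n n) ⟩
      suc n * n + suc n                 ≡⟨ +-comm (suc n * n) (suc n) ⟩
      suc n + suc n * n                 ≡⟨ *-suc (suc n) n ⟨
      suc n * suc n                     ∎)))
    where open ≤-Reasoning

  -- Beyond 2N, the weights of `bc` reach at most 2n, while those of `ac` start at 2n + 2.
  edgeWeight-bc<ac : ∀ j i → edgeWeight labeling (linkEdge (bc j)) ℕ.< edgeWeight labeling (linkEdge (ac i))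
  edgeWeight-bc<ac j i = subst₂ ℕ._<_ (sym (edgeWeight-bc j)) (sym (edgeWeight-ac i))
    (+-monoˡ-< (2 * (suc n * suc n)) (begin-strict
    2 * suc (toℕ j)           ≤⟨ *-monoʳ-≤ 2 (toℕ<n j) ⟩
    2 * n                     <⟨ m<m+n (2 * n) (s≤s z≤n) ⟩
    2 * n + 2                 ≡⟨ lemma n ⟩
    (2 + n) * 1 + n           ≤⟨ +-monoˡ-≤ n (*-monoʳ-≤ (2 + n) (s≤s z≤n)) ⟩
    (2 + n) * suc (toℕ i) + n ∎))
    where
    open ≤-Reasoning
    lemma : ∀ n → 2 * n + 2 ≡ (2 + n) * 1 + n
    lemma = solve-∀

  edgeWeight-ab<bc : ∀ i j k → edgeWeight labeling (linkEdge (ab i j)) ℕ.< edgeWeight labeling (linkEdge (bc k))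
  edgeWeight-ab<bc i j k = <-≤-trans (edgeWeight-ab< i j)
    (subst (2 * (suc n * suc n) ≤_) (sym (edgeWeight-bc k)) (m≤n+m _ (2 * suc (toℕ k))))

  edgeWeight-ab<ac : ∀ i j k → edgeWeight labeling (linkEdge (ab i j)) ℕ.< edgeWeight labeling (linkEdge (ac k))
  edgeWeight-ab<ac i j k = <-≤-trans (edgeWeight-ab< i j)
    (subst (2 * (suc n * suc n) ≤_) (sym (edgeWeight-ac k)) (m≤n+m _ ((2 + n) * suc (toℕ k) + n)))

  -- The three kinds of edges have weights in disjoint ranges, ordered `ab`, `bc`, `ac`; within a
  -- kind the weight is affine with positive slope, in the label for `ab` and in the index
  -- otherwise.
  linkWeight-injective : ∀ l m →
    edgeWeight labeling (linkEdge l) ≡ edgeWeight labeling (linkEdge m) → l ≡ m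
  linkWeight-injective (ab i j) (ab k l) eq = inj₂-injective (number-injective
    (*-cancelˡ-≡ _ _ 2 (trans (sym (edgeWeight-ab i j)) (trans eq (edgeWeight-ab k l)))))
  linkWeight-injective (bc j) (bc l) eq = cong (λ j → bc j) (toℕ-injective (suc-injective
    (*-cancelˡ-≡ _ _ 2 (+-cancelʳ-≡ _ _ _ (trans (sym (edgeWeight-bc j)) (trans eq (edgeWeight-bc l)))))))
  linkWeight-injective (ac i) (ac k) eq = cong (λ i → ac i) (toℕ-injective (suc-injective
    (*-cancelˡ-≡ _ _ (2 + n) (+-cancelʳ-≡ _ _ _ (+-cancelʳ-≡ _ _ _
      (trans (sym (edgeWeight-ac i)) (trans eq (edgeWeight-ac k))))))))
  linkWeight-injective (ab i j) (bc k) eq = contradiction eq (<⇒≢ (edgeWeight-ab<bc i j k))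
  linkWeight-injective (ab i j) (ac k) eq = contradiction eq (<⇒≢ (edgeWeight-ab<ac i j k))
  linkWeight-injective (bc j) (ac i) eq = contradiction eq (<⇒≢ (edgeWeight-bc<ac j i))
  linkWeight-injective (bc k) (ab i j) eq = contradiction (sym eq) (<⇒≢ (edgeWeight-ab<bc i j k))
  linkWeight-injective (ac k) (ab i j) eq = contradiction (sym eq) (<⇒≢ (edgeWeight-ab<ac i j k))
  linkWeight-injective (ac i) (bc j) eq = contradiction (sym eq) (<⇒≢ (edgeWeight-bc<ac j i))

  edgeAntimagic : EdgeAntimagic labeling
  edgeAntimagic {e₁} {e₂} = go (linkEdge-surjective e₁) (linkEdge-surjective e₂)
    where
    go : ∀ {e₁ e₂} → (∃ λ l → linkEdge l ≡ e₁) → (∃ λ m → linkEdge m ≡ e₂) →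
         edgeWeight labeling e₁ ≡ edgeWeight labeling e₂ → e₁ ≡ e₂
    go (l , refl) (m , refl) eq = cong linkEdge (linkWeight-injective l m eq)

  -- Vertex weights.

  incidentLabel : Vertex → Vertex → ℕ
  incidentLabel v u = edgeLabelOr0 labeling (u ~? v)

  incidentLabel-start : ∀ l → incidentLabel (vertex (start l)) (vertex (end l)) ≡ number (inj₂ l)
  incidentLabel-start l =
    -- The decision has the neighbour first, so here the larger end precedes the smaller.
    trans (edgeLabelOr0-> labeling (vertex (end l) ~? vertex (start l)) (start<end l) (start~end l))
      (edgeLabel-linkEdge l)

  incidentLabel-end : ∀ l → incidentLabel (vertex (end l)) (vertex (start l)) ≡ number (inj₂ l)
  incidentLabel-end l =
    trans (edgeLabelOr0-< labeling (vertex (start l) ~? vertex (end l)) (start<end l) (start~end l))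
      (edgeLabel-linkEdge l)

  sum-vertices : ∀ (g : Vertex → ℕ) →
    sum g ≡ (sum (λ i → g (vertex (a i))) + sum (λ j → g (vertex (b j)))) + g (vertex c)
  sum-vertices g = trans (sum-↑ (n + n) g) (cong₂ _+_ (sum-↑ n (λ v → g (v ↑ˡ 1))) (+-identityʳ _))

  sum-vertices-cong : ∀ {g : Vertex → ℕ} {f h : Fin n → ℕ} {x s t} →
    (∀ i → g (vertex (a i)) ≡ f i) → sum f ≡ s →
    (∀ j → g (vertex (b j)) ≡ h j) → sum h ≡ t →
    g (vertex c) ≡ x → sum g ≡ (s + t) + x
  sum-vertices-cong {g} p refl q refl refl =
    trans (sum-vertices g) (cong (_+ g (vertex c)) (cong₂ _+_ (sum-cong-≗ p) (sum-cong-≗ q)))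

  sum-zero : sum {n} (λ _ → 0) ≡ 0
  sum-zero = trans (sum-const n 0) (*-zeroʳ n)

  sum-const+ : ∀ x (f : Fin n → ℕ) → sum (λ i → x + f i) ≡ n * x + sum f
  sum-const+ x f = trans (∑-distrib-+ (λ _ → x) f) (cong (_+ sum f) (sum-const n x))

  vertexWeight-a : ∀ i → vertexWeight labeling (vertex (a i)) ≡ aWeight n (suc (toℕ i))
  vertexWeight-a i = cong₂ _+_ (trans (vertexLabel-vertex (a i)) (number-a i))
    (sum-vertices-cong
      (λ k → edgeLabelOr0-no labeling (vertex (a k) ~? vertex (a i)) (¬a~a k i)) sum-zero
      (λ j → trans (incidentLabel-start (ab i j)) (number-ab i j))
      (sum-const+ (suc n * suc (toℕ i)) (λ j → suc (toℕ j)))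
      (trans (incidentLabel-start (ac i)) (number-ac i)))

  vertexWeight-b : ∀ j → vertexWeight labeling (vertex (b j)) ≡ bWeight n (suc (toℕ j))
  vertexWeight-b j = cong₂ _+_ (trans (vertexLabel-vertex (b j)) (number-b j))
    (trans (sum-vertices-cong
      (λ i → trans (incidentLabel-end (ab i j)) (number-ab i j))
      (trans (∑-distrib-+ {n} (λ i → suc n * suc (toℕ i)) (λ _ → suc (toℕ j)))
        (cong₂ _+_ (sym (*-distribˡ-sum {n} (suc n) (λ i → suc (toℕ i)))) (sum-const n (suc (toℕ j)))))
      (λ k → edgeLabelOr0-no labeling (vertex (b k) ~? vertex (b j)) (¬b~b k j)) sum-zero
      (trans (incidentLabel-start (bc j)) (number-bc j)))
    -- The zero sum stands on the right here and, unlike for `a`, does not vanish by computation.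
    (cong (_+ (suc n * suc n + suc (toℕ j))) (+-identityʳ (suc n * triangle n + n * suc (toℕ j)))))

  vertexWeight-c : vertexWeight labeling (vertex c) ≡ cWeight n
  vertexWeight-c = cong₂ _+_ (trans (vertexLabel-vertex c) number-c)
    (trans (sum-vertices-cong
      (λ i → trans (incidentLabel-end (ac i)) (number-ac i))
      (trans (sum-const+ (suc n * suc n) (λ i → n + suc (toℕ i)))
        (cong (n * (suc n * suc n) +_) (sum-const+ n (λ i → suc (toℕ i)))))
      (λ j → trans (incidentLabel-end (bc j)) (number-bc j))
      (sum-const+ (suc n * suc n) (λ j → suc (toℕ j)))
      (edgeLabelOr0-no labeling (vertex c ~? vertex c) ¬c~c))
    (+-identityʳ _))

-- Distinctness of the vertex weights and conclusion.

module _ (k : ℕ) where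
  open Labeling (4 + k)

  placeWeight-injective : ∀ x y →
    vertexWeight labeling (vertex x) ≡ vertexWeight labeling (vertex y) → x ≡ y
  placeWeight-injective (a i) (a j) eq = cong (λ i → a i) (toℕ-injective (suc-injective
    (aWeight-injective (4 + k) (trans (sym (vertexWeight-a i)) (trans eq (vertexWeight-a j))))))
  placeWeight-injective (b i) (b j) eq = cong (λ i → b i) (toℕ-injective (suc-injective
    (bWeight-injective (4 + k) (trans (sym (vertexWeight-b i)) (trans eq (vertexWeight-b j))))))
  placeWeight-injective c c eq = refl
  placeWeight-injective (a i) (b j) eq = contradiction
    (trans (sym (vertexWeight-a i)) (trans eq (vertexWeight-b j)))
    (aWeight≢bWeight k (s≤s z≤n) (s≤s z≤n) (toℕ<n j))
  placeWeight-injective (b j) (a i) eq = contradiction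
    (trans (sym (vertexWeight-a i)) (trans (sym eq) (vertexWeight-b j)))
    (aWeight≢bWeight k (s≤s z≤n) (s≤s z≤n) (toℕ<n j))
  placeWeight-injective (a i) c eq = contradiction
    (trans (sym (vertexWeight-a i)) (trans eq vertexWeight-c)) (<⇒≢ (aWeight<cWeight (3 + k) (toℕ<n i)))
  placeWeight-injective c (a i) eq = contradiction
    (trans (sym (vertexWeight-a i)) (trans (sym eq) vertexWeight-c)) (<⇒≢ (aWeight<cWeight (3 + k) (toℕ<n i)))
  placeWeight-injective (b j) c eq = contradiction
    (trans (sym (vertexWeight-b j)) (trans eq vertexWeight-c)) (<⇒≢ (bWeight<cWeight (3 + k) (toℕ<n j)))
  placeWeight-injective c (b j) eq = contradiction
    (trans (sym (vertexWeight-b j)) (trans (sym eq) vertexWeight-c)) (<⇒≢ (bWeight<cWeight (3 + k) (toℕ<n j)))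

  vertexAntimagic : VertexAntimagic labeling
  vertexAntimagic {u} {v} =
    go (Inverse.to Vertex↔Place u) (Inverse.to Vertex↔Place v) (vertex-place u) (vertex-place v)
    where
    go : ∀ x y {u v} → vertex x ≡ u → vertex y ≡ v →
         vertexWeight labeling u ≡ vertexWeight labeling v → u ≡ v
    go x y refl refl eq = cong vertex (placeWeight-injective x y eq)

theorem3p1 : (n : ℕ) → n > 3 → IsWeakOrderedSuperEAT K[ n , n ] → IsTAT (K[ n , n ] ⊕ K₁)
theorem3p1 (suc (suc (suc (suc k)))) (s≤s (s≤s (s≤s (s≤s z≤n)))) _ =
  Labeling.labeling (4 + k) , Labeling.edgeAntimagic (4 + k) , vertexAntimagic k
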